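{- Let $n$ and $p$ be integers with $2 < p < n-1$. Then the distinguishing number of the $p$-th graph power $Q_n^p$ of the $n$-dimensional hypercube $Q_n$ is $2$, i.e. $D(Q_n^p) = 2$.
   Context: The $n$-dimensional hypercube $Q_n$ is the graph whose $2^n$ vertices are the binary strings $a_1\cdots a_n$ with $a_i\in\{0,1\}$, two vertices $v_1\cdots v_n$ and $w_1\cdots w_n$ being joined by an edge if and only if $|\{i : v_i\neq w_i\}| = 1$. For a graph $G$, the $p$-th power $G^p$ is the graph with $V(G^p)=V(G)$ and $E(G^p)=\{\{v,w\} : 0<d_G(v,w)\le p\}$, where $d_G(v,w)$ is the length of a shortest path between $v$ and $w$ in $G$. An $r$-coloring of a graph $G$ is any function $c\colon V(G)\to\{1,\dots,r\}$ (not required to be a proper coloring). An automorphism $\pi$ of $G$ preserves $c$ if $c(\pi v)=c(v)$ for every $v\in V(G)$. The coloring $c$ is distinguishing if no nontrivial automorphism of $G$ preserves it. The distinguishing number $D(G)$ is the smallest $r$ such that there exists a distinguishing $r$-coloring of $G$. -}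

module Defs where

open import Data.Bool.Base using (Bool; true; false)
open import Data.Bool.Properties using (_≟_)
open import Data.Fin.Base using (Fin)
open import Data.List.Base using (List; _∷_; [_]; _∷ʳ_)
open import Data.List.Relation.Binary.Permutation.Propositional
  using (_↭_; ↭-refl; ↭-trans; ↭⇒↭ₛ; prep)
open import Data.List.Relation.Binary.Permutation.Propositional.Properties
  using (∷↭∷ʳ)
open import Data.List.Relation.Unary.Unique.Propositional using (Unique)
import Data.List.Relation.Unary.All as All
import Data.List.Relation.Unary.AllPairs as AllPairs
import Data.List.Relation.Binary.Permutation.Setoid.Properties as Perm
open import Data.Nat.Base using (ℕ; zero; suc; _≤_; _<_)
open import Data.Nat.Properties using (≤-trans; <-irrefl)
open import Data.Product using (Σ-syntax; ∃-syntax; _×_; _,_)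
open import Data.Vec.Base using (Vec; []; _∷_; zip; count)
open import Function.Base using (_∘_)
open import Function.Bundles using (_↔_; _⇔_; Inverse)
open import Level using (0ℓ)
open import Relation.Binary.Core using (Rel)
open import Relation.Binary.Construct.Closure.ReflexiveTransitive using (Star; ε; _◅_)
open import Relation.Binary.Definitions using (Symmetric)
open import Relation.Binary.PropositionalEquality
  using (_≡_; _≢_; refl; sym; trans; cong; subst; setoid)
open import Relation.Nullary.Decidable using (¬?)
open import Relation.Nullary.Negation using (¬_)

IsLeast : (ℕ → Set) → ℕ → Set
IsLeast P m = P m × (∀ k → P k → m ≤ k)

record Graph : Set₁ where
  infix 4 _~_
  field
    V          : Set
    _~_        : Rel V 0ℓ
    ~-sym      : Symmetric _~_
    ~-irrefl   : ∀ {v} → ¬ (v ~ v)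

module _ (G : Graph) where
  open Graph G

  Walk : V → V → Set
  Walk = Star _~_

  vertices : ∀ {v w} → Walk v w → List V
  vertices {v} ε       = [ v ]
  vertices {v} (e ◅ p) = v ∷ vertices p

  length : ∀ {v w} → Walk v w → ℕ
  length ε       = zero
  length (e ◅ p) = suc (length p)

  PathOfLength : V → V → ℕ → Set
  PathOfLength v w k = Σ[ p ∈ Walk v w ] Unique (vertices p) × length p ≡ k

  -- A relation rather than a function, since there may be no path.
  IsDistance : V → V → ℕ → Set
  IsDistance v w = IsLeast (PathOfLength v w)

  private
    snoc : ∀ {u v w} → Walk u v → v ~ w → Walk u w
    snoc ε       e = e ◅ ε
    snoc (f ◅ p) e = f ◅ snoc p e

    vertices-snoc : ∀ {u v w} (p : Walk u v) (e : v ~ w) →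
                    vertices (snoc p e) ≡ vertices p ∷ʳ w
    vertices-snoc ε       e = refl
    vertices-snoc (f ◅ p) e = cong (_ ∷_) (vertices-snoc p e)

    length-snoc : ∀ {u v w} (p : Walk u v) (e : v ~ w) →
                  length (snoc p e) ≡ suc (length p)
    length-snoc ε       e = refl
    length-snoc (f ◅ p) e = cong suc (length-snoc p e)

    rev : ∀ {v w} → Walk v w → Walk w v
    rev ε       = ε
    rev (e ◅ p) = snoc (rev p) (~-sym e)

    vertices-rev : ∀ {v w} (p : Walk v w) → vertices p ↭ vertices (rev p)
    vertices-rev ε = ↭-refl
    vertices-rev {v} (e ◅ p) =
      subst (v ∷ vertices p ↭_) (sym (vertices-snoc (rev p) (~-sym e)))
        (↭-trans (prep v (vertices-rev p)) (∷↭∷ʳ v (vertices (rev p))))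

    length-rev : ∀ {v w} (p : Walk v w) → length (rev p) ≡ length p
    length-rev ε       = refl
    length-rev (e ◅ p) =
      trans (length-snoc (rev p) (~-sym e)) (cong suc (length-rev p))

  PathOfLength-sym : ∀ {v w k} → PathOfLength v w k → PathOfLength w v k
  PathOfLength-sym (p , unique , len) =
    rev p , unique-rev , trans (length-rev p) len
    where
    unique-rev = Perm.Unique-resp-↭ (setoid V) (↭⇒↭ₛ (vertices-rev p)) unique

  IsDistance-sym : ∀ {v w d} → IsDistance v w d → IsDistance w v d
  IsDistance-sym (path , least) =
    PathOfLength-sym path , λ k → least k ∘ PathOfLength-sym

  IsDistance-self : ∀ {v d} → IsDistance v v d → d ≤ 0
  IsDistance-self (_ , least) = least 0 (ε , All.[] AllPairs.∷ AllPairs.[] , refl)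

infixl 8 _^ᵍ_

_^ᵍ_ : Graph → ℕ → Graph
G ^ᵍ p = record
  { V        = V
  ; _~_      = λ v w → ∃[ d ] IsDistance G v w d × 0 < d × d ≤ p
  ; ~-sym    = λ (d , dist , bounds) → d , IsDistance-sym G dist , bounds
  ; ~-irrefl = λ (d , dist , 0<d , _) →
      <-irrefl refl (≤-trans 0<d (IsDistance-self G dist))
  }
  where open Graph G

numDiff : ∀ {n} → Vec Bool n → Vec Bool n → ℕ
numDiff v w = count (λ (a , b) → ¬? (a ≟ b)) (zip v w)

numDiff-sym : ∀ {n} (v w : Vec Bool n) → numDiff v w ≡ numDiff w v
numDiff-sym []      []      = refl
numDiff-sym (false ∷ v) (false ∷ w) = numDiff-sym v w
numDiff-sym (false ∷ v) (true  ∷ w) = cong suc (numDiff-sym v w)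
numDiff-sym (true  ∷ v) (false ∷ w) = cong suc (numDiff-sym v w)
numDiff-sym (true  ∷ v) (true  ∷ w) = numDiff-sym v w

numDiff-self : ∀ {n} (v : Vec Bool n) → numDiff v v ≡ 0
numDiff-self []               = refl
numDiff-self (false ∷ v) = numDiff-self v
numDiff-self (true  ∷ v) = numDiff-self v

Q : ℕ → Graph
Q n = record
  { V        = Vec Bool n
  ; _~_      = λ v w → numDiff v w ≡ 1
  ; ~-sym    = λ {v} {w} → trans (numDiff-sym w v)
  ; ~-irrefl = λ {v} eq → 0≢1 (trans (sym (numDiff-self v)) eq)
  }
  where
  0≢1 : 0 ≢ 1
  0≢1 ()

record Automorphism (G : Graph) : Set where
  open Graph G
  field
    permutation : V ↔ V
  open Inverse permutation public using () renaming (to to apply)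
  field
    ~-iff : ∀ v w → (v ~ w) ⇔ (apply v ~ apply w)

module _ (G : Graph) where
  open Graph G
  open Automorphism using (apply)

  Coloring : ℕ → Set
  Coloring r = V → Fin r

  Preserves : ∀ {r} → Automorphism G → Coloring r → Set
  Preserves π c = ∀ v → c (apply π v) ≡ c v

  Trivial : Automorphism G → Set
  Trivial π = ∀ v → apply π v ≡ v

  -- Stated as "every preserving automorphism is trivial", which is
  -- constructively at least as strong as "no nontrivial one preserves c".
  Distinguishing : ∀ {r} → Coloring r → Set
  Distinguishing c = ∀ π → Preserves π c → Trivial π

  IsDistinguishingNumber : ℕ → Set
  IsDistinguishingNumber =
    IsLeast (λ r → Σ[ c ∈ Coloring r ] Distinguishing c)

{-# OPTIONS --safe #-}
-- Two vertices of the cube at distance d have the same number of common points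
-- in their closed balls of radius p for d = 1 and d = 2, and strictly fewer for
-- d ≥ 3, because p < n - 1. Hence an automorphism of the p-th power preserves
-- the relation "at distance at most 2".
--
-- With a parity bit prepended as element 0, the points within distance 2 of the
-- origin become the edges of the complete graph on {0, …, n}, and they are at
-- distance at most 2 from one another iff they share an endpoint. Colour the
-- origin, the n edges of the path 0 — 1 — ⋯ — n and the point {0, 1, 3, 5}. Within
-- distance 2, these form the cone over a path with a pendant vertex attached to
-- one end of the path, and this graph has no nontrivial automorphism. Once they
-- are fixed, so are the edges {0, i} in turn, then all edges, and then every
-- point by induction on its weight.
module Submission where

open import Defs
open import Algebra.Properties.CommutativeSemigroup using (interchange)
open import Data.Bool.Base using (Bool; true; false; not)
open import Data.Bool.Properties using (not-involutive; ¬-not) renaming (_≟_ to _≟ᵇ_)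
open import Data.Empty using (⊥; ⊥-elim)
open import Data.Fin.Base using (Fin; zero; suc; toℕ; inject₁)
open import Data.Fin.Properties as Fin using (any?; toℕ-injective; toℕ-inject₁)
open import Data.List.Base using (List; []; _∷_; map; _++_)
open import Data.List.Membership.Propositional using (_∈_)
open import Data.List.Membership.Propositional.Properties
  using (∈-map⁺; ∈-map⁻; ∈-++⁺ˡ; ∈-++⁺ʳ)
open import Data.List.Membership.Propositional.Properties.WithK using (unique∧set⇒bag)
open import Data.List.Properties using (map-cong; map-∘; map-++)
open import Data.List.Relation.Binary.BagAndSetEquality using (∼bag⇒↭)
open import Data.List.Relation.Binary.Permutation.Propositional using (_↭_)
open import Data.List.Relation.Binary.Permutation.Propositional.Properties using (map⁺)
open import Data.List.Relation.Unary.All as All using (All; []; _∷_)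
open import Data.List.Relation.Unary.AllPairs using ([]; _∷_)
open import Data.List.Relation.Unary.Any using (here)
open import Data.List.Relation.Unary.Unique.Propositional using (Unique)
import Data.List.Relation.Unary.Unique.Propositional.Properties as Unique
open import Data.Nat.Base
open import Data.Nat.Induction using (<-rec)
open import Data.Nat.ListAction using (sum)
open import Data.Nat.ListAction.Properties using (sum-++; sum-↭)
open import Data.Nat.Properties
open import Data.Nat.Tactic.RingSolver using (solve-∀)
open import Data.Product using (∃-syntax; Σ-syntax; _×_; _,_; proj₁; proj₂)
open import Data.Sum.Base using (_⊎_; inj₁; inj₂; [_,_]′)
open import Data.Vec.Base using (Vec; []; _∷_; lookup; replicate; updateAt)
open import Data.Vec.Properties
  using (≡-dec; ∷-injectiveʳ; lookup-replicate; lookup∘updateAt; lookup∘updateAt′;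
         updateAt-id-local; updateAt-updateAt)
open import Function.Base using (_∘_; case_of_; id)
open import Function.Bundles using (_⇔_; _↔_; mk⇔; mk↔ₛ′; Equivalence; Injection; Inverse)
open import Function.Construct.Symmetry using (⇔-sym)
open import Function.Properties.Inverse using (↔⇒↣; ↔-sym)
open import Relation.Binary.Construct.Closure.ReflexiveTransitive using (ε; _◅_)
open import Relation.Binary.PropositionalEquality hiding ([_])
open import Relation.Nullary.Decidable using (Dec; yes; no)
open import Relation.Nullary.Negation using (¬_; contradiction)

private variable
  n k : ℕ

-- Distances in the cube

numDiff-triangle : ∀ (u v w : Vec Bool n) → numDiff u w ≤ numDiff u v + numDiff v w
numDiff-triangle [] [] [] = z≤n
numDiff-triangle (false ∷ u) (false ∷ v) (false ∷ w) = numDiff-triangle u v w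
numDiff-triangle (false ∷ u) (false ∷ v) (true ∷ w) =
  ≤-trans (s≤s (numDiff-triangle u v w)) (≤-reflexive (sym (+-suc _ _)))
numDiff-triangle (false ∷ u) (true ∷ v) (false ∷ w) =
  m≤n⇒m≤1+n (≤-trans (numDiff-triangle u v w) (+-monoʳ-≤ _ (n≤1+n _)))
numDiff-triangle (false ∷ u) (true ∷ v) (true ∷ w) = s≤s (numDiff-triangle u v w)
numDiff-triangle (true ∷ u) (false ∷ v) (false ∷ w) = s≤s (numDiff-triangle u v w)
numDiff-triangle (true ∷ u) (false ∷ v) (true ∷ w) =
  m≤n⇒m≤1+n (≤-trans (numDiff-triangle u v w) (+-monoʳ-≤ _ (n≤1+n _)))
numDiff-triangle (true ∷ u) (true ∷ v) (false ∷ w) =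
  ≤-trans (s≤s (numDiff-triangle u v w)) (≤-reflexive (sym (+-suc _ _)))
numDiff-triangle (true ∷ u) (true ∷ v) (true ∷ w) = numDiff-triangle u v w

numDiff≡0⇒≡ : ∀ (v w : Vec Bool n) → numDiff v w ≡ 0 → v ≡ w
numDiff≡0⇒≡ [] [] _ = refl
numDiff≡0⇒≡ (false ∷ v) (false ∷ w) eq = cong (false ∷_) (numDiff≡0⇒≡ v w eq)
numDiff≡0⇒≡ (true ∷ v) (true ∷ w) eq = cong (true ∷_) (numDiff≡0⇒≡ v w eq)

flip : Fin n → Vec Bool n → Vec Bool n
flip i v = updateAt v i not

flip-involutive : ∀ i (v : Vec Bool n) → flip i (flip i v) ≡ v
flip-involutive i v = trans (updateAt-updateAt i v)
  (updateAt-id-local i v (not-involutive (lookup v i)))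

lookup-flip : ∀ i (v : Vec Bool n) → lookup (flip i v) i ≡ not (lookup v i)
lookup-flip i v = lookup∘updateAt i v

lookup-flip-≢ : ∀ {i j} (v : Vec Bool n) → i ≢ j → lookup (flip j v) i ≡ lookup v i
lookup-flip-≢ {i = i} {j} v i≢j = lookup∘updateAt′ i j i≢j v

flip-agree : ∀ i (u v : Vec Bool n) → lookup u i ≡ lookup v i →
             numDiff u (flip i v) ≡ suc (numDiff u v)
flip-agree zero (false ∷ u) (false ∷ v) _ = refl
flip-agree zero (true ∷ u) (true ∷ v) _ = refl
flip-agree (suc i) (false ∷ u) (false ∷ v) eq = flip-agree i u v eq
flip-agree (suc i) (false ∷ u) (true ∷ v) eq = cong suc (flip-agree i u v eq)
flip-agree (suc i) (true ∷ u) (false ∷ v) eq = cong suc (flip-agree i u v eq)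
flip-agree (suc i) (true ∷ u) (true ∷ v) eq = flip-agree i u v eq

flip-differ : ∀ i (u v : Vec Bool n) → lookup u i ≡ not (lookup v i) →
              suc (numDiff u (flip i v)) ≡ numDiff u v
flip-differ i u v eq = trans
  (sym (flip-agree i u (flip i v) (trans eq (sym (lookup-flip i v)))))
  (cong (numDiff u) (flip-involutive i v))

numDiff-flip : ∀ i (v : Vec Bool n) → numDiff v (flip i v) ≡ 1
numDiff-flip i v = trans (flip-agree i v v refl) (cong suc (numDiff-self v))

numDiff-flip-flip : ∀ i (v w : Vec Bool n) → numDiff (flip i v) (flip i w) ≡ numDiff v w
numDiff-flip-flip zero (false ∷ v) (false ∷ w) = refl
numDiff-flip-flip zero (false ∷ v) (true ∷ w) = refl
numDiff-flip-flip zero (true ∷ v) (false ∷ w) = refl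
numDiff-flip-flip zero (true ∷ v) (true ∷ w) = refl
numDiff-flip-flip (suc i) (false ∷ v) (false ∷ w) = numDiff-flip-flip i v w
numDiff-flip-flip (suc i) (false ∷ v) (true ∷ w) = cong suc (numDiff-flip-flip i v w)
numDiff-flip-flip (suc i) (true ∷ v) (false ∷ w) = cong suc (numDiff-flip-flip i v w)
numDiff-flip-flip (suc i) (true ∷ v) (true ∷ w) = numDiff-flip-flip i v w

differing-coordinate : ∀ (v w : Vec Bool n) {d} → numDiff v w ≡ suc d →
                       ∃[ i ] lookup v i ≡ not (lookup w i)
differing-coordinate [] [] ()
differing-coordinate (false ∷ v) (true ∷ w) _ = zero , refl
differing-coordinate (true ∷ v) (false ∷ w) _ = zero , refl
differing-coordinate (false ∷ v) (false ∷ w) eq =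
  let i , p = differing-coordinate v w eq in suc i , p
differing-coordinate (true ∷ v) (true ∷ w) eq =
  let i , p = differing-coordinate v w eq in suc i , p

numDiff≤length : ∀ {v w} (walk : Walk (Q n) v w) → numDiff v w ≤ length (Q n) walk
numDiff≤length {v = v} ε = ≤-reflexive (numDiff-self v)
numDiff≤length {n} {v} {w} (_◅_ {j = u} e walk) = begin
  numDiff v w                 ≤⟨ numDiff-triangle v u w ⟩
  numDiff v u + numDiff u w   ≡⟨ cong (_+ numDiff u w) e ⟩
  suc (numDiff u w)           ≤⟨ s≤s (numDiff≤length walk) ⟩
  suc (length (Q n) walk)     ∎
  where open ≤-Reasoning

-- The bound on the vertices makes the geodesic duplicate-free: each new first
-- vertex is strictly farther from w than all later ones.
geodesic : ∀ d (v w : Vec Bool n) → numDiff v w ≡ d →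
           Σ[ path ∈ PathOfLength (Q n) v w d ]
             All (λ x → numDiff x w ≤ d) (vertices (Q n) (proj₁ path))
geodesic zero v w eq with refl ← numDiff≡0⇒≡ v w eq =
  (ε , [] ∷ [] , refl) , ≤-reflexive eq ∷ []
geodesic (suc d) v w eq =
  let i , differ = differing-coordinate v w eq
      u≡d = suc-injective (begin
        suc (numDiff (flip i v) w)  ≡⟨ cong suc (numDiff-sym (flip i v) w) ⟩
        suc (numDiff w (flip i v))  ≡⟨ flip-differ i w v
                                         (trans (sym (not-involutive _)) (cong not (sym differ))) ⟩
        numDiff w v                 ≡⟨ numDiff-sym w v ⟩
        numDiff v w                 ≡⟨ eq ⟩
        suc d                       ∎)
      (walk , unique , len) , near = geodesic d (flip i v) w u≡d
      fresh = All.map (λ {x} x≤d → λ { refl → <-irrefl eq (s≤s x≤d) }) near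
  in (numDiff-flip i v ◅ walk , fresh ∷ unique , cong suc len) ,
     ≤-reflexive eq ∷ All.map m≤n⇒m≤1+n near
  where open ≡-Reasoning

-- The geodesic attains the Hamming distance and the triangle inequality bounds every walk from
-- below, so graph distance in the cube is Hamming distance.
numDiff-isDistance : ∀ (v w : Vec Bool n) → IsDistance (Q n) v w (numDiff v w)
numDiff-isDistance v w =
  proj₁ (geodesic _ v w refl) ,
  λ { _ (walk , _ , refl) → numDiff≤length walk }

isDistance⇒≡numDiff : ∀ {v w : Vec Bool n} {d} → IsDistance (Q n) v w d → d ≡ numDiff v w
isDistance⇒≡numDiff {v = v} {w} {d} (path , least) =
  let path′ , least′ = numDiff-isDistance v w
  in ≤-antisym (least _ path′) (least′ d path)

-- Counting common points of balls

cube : ∀ n → List (Vec Bool n)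
cube zero    = [] ∷ []
cube (suc n) = map (false ∷_) (cube n) ++ map (true ∷_) (cube n)

cube-complete : ∀ (v : Vec Bool n) → v ∈ cube n
cube-complete [] = here refl
cube-complete (false ∷ v) = ∈-++⁺ˡ (∈-map⁺ (false ∷_) (cube-complete v))
cube-complete (true ∷ v) = ∈-++⁺ʳ _ (∈-map⁺ (true ∷_) (cube-complete v))

cube-unique : ∀ n → Unique (cube n)
cube-unique zero    = [] ∷ []
cube-unique (suc n) = Unique.++⁺
  (Unique.map⁺ ∷-injectiveʳ (cube-unique n))
  (Unique.map⁺ ∷-injectiveʳ (cube-unique n))
  λ (∈f , ∈t) → case ∈-map⁻ (false ∷_) ∈f , ∈-map⁻ (true ∷_) ∈t of λ where
    ((_ , _ , refl) , (_ , _ , ()))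

∑ : (Vec Bool n → ℕ) → ℕ
∑ {n} f = sum (map f (cube n))

∑-cong : ∀ {f g : Vec Bool n → ℕ} → (∀ v → f v ≡ g v) → ∑ f ≡ ∑ g
∑-cong {n} f≗g = cong sum (map-cong f≗g (cube n))

∑-suc : ∀ (f : Vec Bool (suc n) → ℕ) → ∑ f ≡ ∑ (f ∘ (false ∷_)) + ∑ (f ∘ (true ∷_))
∑-suc {n} f = begin
  sum (map f (map (false ∷_) (cube n) ++ map (true ∷_) (cube n)))
    ≡⟨ cong sum (map-++ f (map (false ∷_) (cube n)) _) ⟩
  sum (map f (map (false ∷_) (cube n)) ++ map f (map (true ∷_) (cube n)))
    ≡⟨ sum-++ (map f (map (false ∷_) (cube n))) _ ⟩
  sum (map f (map (false ∷_) (cube n))) + sum (map f (map (true ∷_) (cube n)))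
    ≡⟨ cong₂ (λ xs ys → sum xs + sum ys) (map-∘ (cube n)) (map-∘ (cube n)) ⟨
  ∑ (f ∘ (false ∷_)) + ∑ (f ∘ (true ∷_)) ∎
  where open ≡-Reasoning

-- Mapping a bijection over the duplicate-free, complete list `cube n` yields another such list,
-- hence a permutation of it.
∑-permute : ∀ (π : Vec Bool n ↔ Vec Bool n) f → ∑ (f ∘ Inverse.to π) ≡ ∑ f
∑-permute {n} π f = begin
  sum (map (f ∘ to) (cube n))     ≡⟨ cong sum (map-∘ (cube n)) ⟩
  sum (map f (map to (cube n)))   ≡⟨ sum-↭ (map⁺ f permuted) ⟩
  sum (map f (cube n))            ∎
  where
  open ≡-Reasoning
  open Inverse π
  permuted : map to (cube n) ↭ cube n
  permuted = ∼bag⇒↭ (unique∧set⇒bag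
    (Unique.map⁺ (Injection.injective (↔⇒↣ π)) (cube-unique n)) (cube-unique n)
    (λ {v} → mk⇔ (λ _ → cube-complete v)
                 (λ _ → subst (_∈ map to (cube n)) (strictlyInverseˡ v)
                          (∈-map⁺ to (cube-complete (from v))))))

Weight : Set
Weight = ℕ → ℕ → ℕ

-- The sum of φ (numDiff v u) (numDiff w u) over all u, for v and w agreeing in
-- s coordinates and differing in d coordinates.
Φ : ℕ → ℕ → Weight → ℕ
Φ zero    zero    φ = φ 0 0
Φ zero    (suc d) φ = Φ zero d (λ a b → φ a (suc b)) + Φ zero d (λ a b → φ (suc a) b)
Φ (suc s) d       φ = Φ s d φ + Φ s d (λ a b → φ (suc a) (suc b))

-- The definition of `Φ` peels off agreeing coordinates first; this peels off a differing one for
-- any `s`.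
Φ-suc : ∀ s d φ →
  Φ s (suc d) φ ≡ Φ s d (λ a b → φ a (suc b)) + Φ s d (λ a b → φ (suc a) b)
Φ-suc zero    d φ = refl
Φ-suc (suc s) d φ = trans
  (cong₂ _+_ (Φ-suc s d φ) (Φ-suc s d (λ a b → φ (suc a) (suc b))))
  (interchange +-commutativeSemigroup (Φ s d (λ a b → φ a (suc b))) _ _ _)

Φ-cong : ∀ s d {φ ψ} → (∀ a b → φ a b ≡ ψ a b) → Φ s d φ ≡ Φ s d ψ
Φ-cong zero    zero    eq = eq 0 0
Φ-cong zero    (suc d) eq =
  cong₂ _+_ (Φ-cong zero d (λ a b → eq a (suc b))) (Φ-cong zero d (λ a b → eq (suc a) b))
Φ-cong (suc s) d       eq =
  cong₂ _+_ (Φ-cong s d eq) (Φ-cong s d (λ a b → eq (suc a) (suc b)))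

Φ-+ : ∀ s d φ ψ → Φ s d (λ a b → φ a b + ψ a b) ≡ Φ s d φ + Φ s d ψ
Φ-+ zero    zero    φ ψ = refl
Φ-+ zero    (suc d) φ ψ = trans
  (cong₂ _+_ (Φ-+ zero d (λ a b → φ a (suc b)) (λ a b → ψ a (suc b)))
             (Φ-+ zero d (λ a b → φ (suc a) b) (λ a b → ψ (suc a) b)))
  (interchange +-commutativeSemigroup (Φ zero d (λ a b → φ a (suc b))) _ _ _)
Φ-+ (suc s) d       φ ψ = trans
  (cong₂ _+_ (Φ-+ s d φ ψ)
             (Φ-+ s d (λ a b → φ (suc a) (suc b)) (λ a b → ψ (suc a) (suc b))))
  (interchange +-commutativeSemigroup (Φ s d φ) _ _ _)

-- For `d = 0` the centres coincide, so only diagonal values of `φ` enter the sum.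
Φ-diagonal-zero : ∀ s φ → (∀ a → φ a a ≡ 0) → Φ s 0 φ ≡ 0
Φ-diagonal-zero zero    φ eq = eq 0
Φ-diagonal-zero (suc s) φ eq =
  cong₂ _+_ (Φ-diagonal-zero s φ eq) (Φ-diagonal-zero s _ (eq ∘ suc))

Φ-diagonal-pos : ∀ {s a} φ → a ≤ s → 0 < φ a a → 0 < Φ s 0 φ
Φ-diagonal-pos {zero}  φ z≤n pos = pos
Φ-diagonal-pos {suc s} φ z≤n pos = <-≤-trans (Φ-diagonal-pos {s} φ z≤n pos) (m≤m+n _ _)
Φ-diagonal-pos {suc s} φ (s≤s a≤s) pos =
  <-≤-trans (Φ-diagonal-pos {s} _ a≤s pos) (m≤n+m _ (Φ s 0 φ))

same : Vec Bool n → Vec Bool n → ℕ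
same []          []          = 0
same (false ∷ v) (false ∷ w) = suc (same v w)
same (false ∷ v) (true  ∷ w) = same v w
same (true  ∷ v) (false ∷ w) = same v w
same (true  ∷ v) (true  ∷ w) = suc (same v w)

same+numDiff : ∀ (v w : Vec Bool n) → same v w + numDiff v w ≡ n
same+numDiff [] [] = refl
same+numDiff (false ∷ v) (false ∷ w) = cong suc (same+numDiff v w)
same+numDiff (false ∷ v) (true  ∷ w) = trans (+-suc _ _) (cong suc (same+numDiff v w))
same+numDiff (true  ∷ v) (false ∷ w) = trans (+-suc _ _) (cong suc (same+numDiff v w))
same+numDiff (true  ∷ v) (true  ∷ w) = cong suc (same+numDiff v w)

-- Split on the first bit of `u`: where `v` and `w` agree it raises both distances or neither, where
-- they differ it raises exactly one.
∑-distances : ∀ (v w : Vec Bool n) φ →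
  ∑ (λ u → φ (numDiff v u) (numDiff w u)) ≡ Φ (same v w) (numDiff v w) φ
∑-distances [] [] φ = +-identityʳ (φ 0 0)
∑-distances (false ∷ v) (false ∷ w) φ = trans
  (∑-suc (λ u → φ (numDiff (false ∷ v) u) (numDiff (false ∷ w) u)))
  (cong₂ _+_ (∑-distances v w φ) (∑-distances v w (λ a b → φ (suc a) (suc b))))
∑-distances (true ∷ v) (true ∷ w) φ = trans
  (∑-suc (λ u → φ (numDiff (true ∷ v) u) (numDiff (true ∷ w) u))) (trans
  (cong₂ _+_ (∑-distances v w (λ a b → φ (suc a) (suc b))) (∑-distances v w φ))
  (+-comm (Φ (same v w) (numDiff v w) (λ a b → φ (suc a) (suc b))) _))
∑-distances (false ∷ v) (true ∷ w) φ = trans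
  (∑-suc (λ u → φ (numDiff (false ∷ v) u) (numDiff (true ∷ w) u))) (trans
  (cong₂ _+_ (∑-distances v w (λ a b → φ a (suc b))) (∑-distances v w (λ a b → φ (suc a) b)))
  (sym (Φ-suc (same v w) _ φ)))
∑-distances (true ∷ v) (false ∷ w) φ = trans
  (∑-suc (λ u → φ (numDiff (true ∷ v) u) (numDiff (false ∷ w) u))) (trans
  (cong₂ _+_ (∑-distances v w (λ a b → φ (suc a) b)) (∑-distances v w (λ a b → φ a (suc b)))) (trans
  (+-comm (Φ (same v w) (numDiff v w) (λ a b → φ (suc a) b)) _)
  (sym (Φ-suc (same v w) _ φ))))

-- Indicators of balls and spheres, and the recursion for common points

[_≤_] : ℕ → ℕ → ℕ
[ zero  ≤ p     ] = 1
[ suc a ≤ zero  ] = 0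
[ suc a ≤ suc p ] = [ a ≤ p ]

[_≡_] : ℕ → ℕ → ℕ
[ zero  ≡ zero  ] = 1
[ zero  ≡ suc p ] = 0
[ suc a ≡ zero  ] = 0
[ suc a ≡ suc p ] = [ a ≡ p ]

[≤]-split : ∀ a p → [ a ≤ p ] ≡ [ suc a ≤ p ] + [ a ≡ p ]
[≤]-split zero    zero    = refl
[≤]-split zero    (suc p) = refl
[≤]-split (suc a) zero    = refl
[≤]-split (suc a) (suc p) = [≤]-split a p

[≤]-true : ∀ {a p} → a ≤ p → [ a ≤ p ] ≡ 1
[≤]-true z≤n = refl
[≤]-true (s≤s a≤p) = [≤]-true a≤p

[≤]-false : ∀ {a p} → p < a → [ a ≤ p ] ≡ 0
[≤]-false (s≤s z≤n) = refl
[≤]-false (s≤s (s≤s p<a)) = [≤]-false (s≤s p<a)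

[≡]-refl : ∀ p → [ p ≡ p ] ≡ 1
[≡]-refl zero = refl
[≡]-refl (suc p) = [≡]-refl p

[≡]-consecutive : ∀ a p → [ a ≡ p ] * [ suc a ≡ p ] ≡ 0
[≡]-consecutive zero    zero          = refl
[≡]-consecutive zero    (suc p) = refl
[≡]-consecutive (suc a) zero    = refl
[≡]-consecutive (suc a) (suc p) = [≡]-consecutive a p

inBalls onSpheres : ℕ → Weight
inBalls   p a b = [ a ≤ p ] * [ b ≤ p ]
onSpheres p a b = [ a ≡ p ] * [ b ≡ p ]

-- The number of common points of two balls of radius p whose centres are at
-- distance d, where n = s + d.
common : ℕ → ℕ → ℕ → ℕ
common p s d = Φ s d (inBalls p)

-- Turning one agreeing coordinate into a differing one loses exactly the points that lie at
-- distance `p` from both centres in the remaining coordinates.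
common-step : ∀ p s d → common p (suc s) d ≡ common p s (suc d) + Φ s d (onSpheres p)
common-step p s d = begin
  Φ s d (inBalls p) + Φ s d (λ a b → inBalls p (suc a) (suc b))
    ≡⟨ Φ-+ s d (inBalls p) _ ⟨
  Φ s d (λ a b → inBalls p a b + inBalls p (suc a) (suc b))
    ≡⟨ Φ-cong s d pointwise ⟩
  Φ s d (λ a b → inBalls p a (suc b) + inBalls p (suc a) b + onSpheres p a b)
    ≡⟨ Φ-+ s d _ (onSpheres p) ⟩
  Φ s d (λ a b → inBalls p a (suc b) + inBalls p (suc a) b) + Φ s d (onSpheres p)
    ≡⟨ cong (_+ Φ s d (onSpheres p)) (trans (Φ-+ s d _ _) (sym (Φ-suc s d (inBalls p)))) ⟩
  Φ s (suc d) (inBalls p) + Φ s d (onSpheres p) ∎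
  where
  open ≡-Reasoning
  -- `x` and `y` indicate distance below `p`, while `e` and `f` indicate distance exactly `p`, so
  -- `x + e` and `y + f` are the ball indicators of `[≤]-split`.
  expand : ∀ x y e f → (x + e) * (y + f) + x * y ≡ (x + e) * y + x * (y + f) + e * f
  expand = solve-∀
  pointwise : ∀ a b → inBalls p a b + inBalls p (suc a) (suc b) ≡
                      inBalls p a (suc b) + inBalls p (suc a) b + onSpheres p a b
  pointwise a b rewrite [≤]-split a p | [≤]-split b p =
    expand [ suc a ≤ p ] [ suc b ≤ p ] [ a ≡ p ] [ b ≡ p ]

-- Points equidistant from two centres exist only if the centres are at even distance.
common-1≡2 : ∀ p s → common p (suc s) 1 ≡ common p s 2
common-1≡2 p s = begin
  common p (suc s) 1                     ≡⟨ common-step p s 1 ⟩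
  common p s 2 + Φ s 1 (onSpheres p)     ≡⟨ cong (common p s 2 +_) (Φ-suc s 0 (onSpheres p)) ⟩
  common p s 2 + (Φ s 0 (λ a b → onSpheres p a (suc b)) + Φ s 0 (λ a b → onSpheres p (suc a) b))
    ≡⟨ cong (common p s 2 +_) (cong₂ _+_
         (Φ-diagonal-zero s _ (λ a → [≡]-consecutive a p))
         (Φ-diagonal-zero s _ (λ a → trans (*-comm [ suc a ≡ p ] _) ([≡]-consecutive a p)))) ⟩
  common p s 2 + 0                       ≡⟨ +-identityʳ _ ⟩
  common p s 2                           ∎
  where open ≡-Reasoning

-- The loss in `common-step` is positive: a point that agrees with each centre in one of the two
-- differing coordinates, and departs from both in `p` of the `s` agreeing ones, is at distance
-- `suc p` from both.
common-3<2 : ∀ p s → p ≤ s → common (suc p) s 3 < common (suc p) (suc s) 2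
common-3<2 p s p≤s = begin-strict
  common (suc p) s 3                             ≡⟨ +-identityʳ _ ⟨
  common (suc p) s 3 + 0                         <⟨ +-monoʳ-< (common (suc p) s 3) pos ⟩
  common (suc p) s 3 + Φ s 2 (onSpheres (suc p)) ≡⟨ common-step (suc p) s 2 ⟨
  common (suc p) (suc s) 2                       ∎
  where
  open ≤-Reasoning
  ψ = onSpheres (suc p)
  pos : 0 < Φ s 2 ψ
  pos = begin-strict
    0                                   <⟨ Φ-diagonal-pos (λ a b → ψ (suc a) (suc b)) p≤s
                                             (≤-reflexive (sym (cong₂ _*_ ([≡]-refl p) ([≡]-refl p)))) ⟩
    Φ s 0 (λ a b → ψ (suc a) (suc b))   ≤⟨ m≤n+m _ _ ⟩
    _ + Φ s 0 (λ a b → ψ (suc a) (suc b)) ≡⟨ Φ-suc s 0 (λ a b → ψ a (suc b)) ⟨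
    Φ s 1 (λ a b → ψ a (suc b))         ≤⟨ m≤m+n _ _ ⟩
    Φ s 1 (λ a b → ψ a (suc b)) + _     ≡⟨ Φ-suc s 1 ψ ⟨
    Φ s 2 ψ                             ∎

-- Iterates `common-step`, discarding the sphere term each time.
common-antitone : ∀ p s k d → common p s (k + d) ≤ common p (k + s) d
common-antitone p s zero    d = ≤-refl
common-antitone p s (suc k) d = begin
  common p s (suc (k + d))   ≤⟨ m≤m+n _ (Φ s (k + d) (onSpheres p)) ⟩
  common p s (suc (k + d)) + Φ s (k + d) (onSpheres p)
                             ≡⟨ common-step p s (k + d) ⟨
  common p (suc s) (k + d)   ≤⟨ common-antitone p (suc s) k d ⟩
  common p (k + suc s) d     ≡⟨ cong (λ t → common p t d) (+-suc k s) ⟩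
  common p (suc k + s) d     ∎
  where open ≤-Reasoning

-- Automorphisms of the power preserve distance at most 2

[≤]-cong : ∀ {a b p} → (a ≤ p) ⇔ (b ≤ p) → [ a ≤ p ] ≡ [ b ≤ p ]
[≤]-cong {a} {b} {p} a⇔b with a ≤? p | b ≤? p
... | yes a≤p | yes b≤p = trans ([≤]-true a≤p) (sym ([≤]-true b≤p))
... | yes a≤p | no  b≰p = contradiction (Equivalence.to a⇔b a≤p) b≰p
... | no  a≰p | yes b≤p = contradiction (Equivalence.from a⇔b b≤p) a≰p
... | no  a≰p | no  b≰p = trans ([≤]-false (≰⇒> a≰p)) (sym ([≤]-false (≰⇒> b≰p)))

Isometric≤ : ℕ → Vec Bool n ↔ Vec Bool n → Set
Isometric≤ p π = ∀ v w → (numDiff v w ≤ p) ⇔ (numDiff (to v) (to w) ≤ p)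
  where open Inverse π

isometric≤-sym : ∀ {p} {π : Vec Bool n ↔ Vec Bool n} →
                 Isometric≤ p π → Isometric≤ p (↔-sym π)
isometric≤-sym {p = p} {π} iso v w =
  subst₂ (λ x y → (numDiff x y ≤ p) ⇔ (numDiff (from v) (from w) ≤ p))
    (strictlyInverseˡ v) (strictlyInverseˡ w)
    (⇔-sym (iso (from v) (from w)))
  where open Inverse π

power-adjacent⇔ : ∀ {p} {v w : Vec Bool n} →
  Graph._~_ (Q n ^ᵍ p) v w ⇔ (0 < numDiff v w × numDiff v w ≤ p)
power-adjacent⇔ {v = v} {w} = mk⇔
  (λ (d , dist , 0<d , d≤p) → subst (λ e → 0 < e × e ≤ _) (isDistance⇒≡numDiff dist) (0<d , d≤p))
  (λ bounds → numDiff v w , numDiff-isDistance v w , bounds)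

-- Adjacency in the power excludes equal points, so distance zero is handled separately; in the
-- backward direction this uses injectivity.
automorphism-isometric≤ : ∀ {p} (π : Automorphism (Q n ^ᵍ p)) →
                          Isometric≤ p (Automorphism.permutation π)
automorphism-isometric≤ {p = p} π v w = mk⇔ forth back
  where
  open Automorphism π
  forth : numDiff v w ≤ p → numDiff (apply v) (apply w) ≤ p
  forth d≤p with numDiff v w ≟ 0
  ... | yes d≡0 with refl ← numDiff≡0⇒≡ v w d≡0 =
    subst (_≤ p) (sym (numDiff-self (apply v))) z≤n
  ... | no  d≢0 = proj₂ (Equivalence.to power-adjacent⇔
    (Equivalence.to (~-iff v w) (Equivalence.from power-adjacent⇔ (n≢0⇒n>0 d≢0 , d≤p))))
  back : numDiff (apply v) (apply w) ≤ p → numDiff v w ≤ p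
  back d≤p with numDiff (apply v) (apply w) ≟ 0
  ... | yes d≡0 with refl ← Injection.injective (↔⇒↣ permutation) (numDiff≡0⇒≡ _ _ d≡0) =
    subst (_≤ p) (sym (numDiff-self v)) z≤n
  ... | no  d≢0 = proj₂ (Equivalence.to power-adjacent⇔
    (Equivalence.from (~-iff v w) (Equivalence.from power-adjacent⇔ (n≢0⇒n>0 d≢0 , d≤p))))

common-max : ∀ {p s d} → s + d ≡ suc n → 0 < d → d ≤ 2 → common p s d ≡ common p n 1
common-max {p = p} {s} {1} eq _ _ =
  cong (λ t → common p t 1) (suc-injective (trans (+-comm 1 s) eq))
common-max {p = p} {s} {2} eq _ _ = trans (sym (common-1≡2 p s))
  (cong (λ t → common p t 1) (suc-injective (trans (+-comm 2 s) eq)))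
common-max {d = suc (suc (suc _))} _ _ (s≤s (s≤s ()))

-- In dimension `3 + n` with radius `suc p`, the bound `p ≤ n` says that the radius is less than the
-- dimension minus one. The drop from distance 2 to 3 is then strict, and larger distances only
-- lower the count.
common-small : ∀ {p s d} → s + d ≡ 3 + n → p ≤ n → 2 < d →
               common (suc p) s d < common (suc p) (2 + n) 1
common-small {n} {p} {s} {suc (suc (suc k))} eq p≤n (s≤s (s≤s (s≤s z≤n))) = begin-strict
  common (suc p) s (3 + k)     ≡⟨ cong (common (suc p) s) (+-comm 3 k) ⟩
  common (suc p) s (k + 3)     ≤⟨ common-antitone (suc p) s k 3 ⟩
  common (suc p) (k + s) 3     ≡⟨ cong (λ t → common (suc p) t 3) k+s≡n ⟩
  common (suc p) n 3           <⟨ common-3<2 p n p≤n ⟩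
  common (suc p) (suc n) 2     ≡⟨ common-1≡2 (suc p) (suc n) ⟨
  common (suc p) (2 + n) 1     ∎
  where
  open ≤-Reasoning
  k+s≡n : k + s ≡ n
  k+s≡n = +-cancelˡ-≡ 3 (k + s) n (trans (+-comm (3 + k) s) eq)

isometric≤2-forth : ∀ {p} → p ≤ n → (π : Vec Bool (3 + n) ↔ Vec Bool (3 + n)) →
  Isometric≤ (suc p) π → ∀ v w →
  numDiff v w ≤ 2 → numDiff (Inverse.to π v) (Inverse.to π w) ≤ 2
isometric≤2-forth {n} {p} p≤n π iso v w d≤2 with numDiff v w in eq
... | zero with refl ← numDiff≡0⇒≡ v w eq = subst (_≤ 2) (sym (numDiff-self (Inverse.to π v))) z≤n
-- The number of common points is invariant under `π`, so an image distance above 2 would put it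
-- strictly below its own value.
... | suc d = ≮⇒≥ λ 2<d′ → <-irrefl (trans (sym invariant) (common-max (same+d v w eq) z<s d≤2))
    (common-small (same+numDiff (to v) (to w)) p≤n 2<d′)
  where
  open Inverse π
  open ≡-Reasoning
  same+d : ∀ (v w : Vec Bool (3 + n)) {e} → numDiff v w ≡ e → same v w + e ≡ 3 + n
  same+d v w refl = same+numDiff v w
  invariant : common (suc p) (same v w) (suc d) ≡
              common (suc p) (same (to v) (to w)) (numDiff (to v) (to w))
  invariant = begin
    common (suc p) (same v w) (suc d)
      ≡⟨ cong (common (suc p) (same v w)) eq ⟨
    common (suc p) (same v w) (numDiff v w)
      ≡⟨ ∑-distances v w (inBalls (suc p)) ⟨
    ∑ (λ u → [ numDiff v u ≤ suc p ] * [ numDiff w u ≤ suc p ])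
      -- Ball membership transfers point by point; reindexing along `π` then replaces `to u` by `u`.
      ≡⟨ ∑-cong (λ u → cong₂ _*_ ([≤]-cong (iso v u)) ([≤]-cong (iso w u))) ⟩
    ∑ (λ u → [ numDiff (to v) (to u) ≤ suc p ] * [ numDiff (to w) (to u) ≤ suc p ])
      ≡⟨ ∑-permute π (λ u → [ numDiff (to v) u ≤ suc p ] * [ numDiff (to w) u ≤ suc p ]) ⟩
    ∑ (λ u → [ numDiff (to v) u ≤ suc p ] * [ numDiff (to w) u ≤ suc p ])
      ≡⟨ ∑-distances (to v) (to w) (inBalls (suc p)) ⟩
    common (suc p) (same (to v) (to w)) (numDiff (to v) (to w)) ∎

isometric≤2 : ∀ {p} → p ≤ n → (π : Vec Bool (3 + n) ↔ Vec Bool (3 + n)) →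
              Isometric≤ (suc p) π → Isometric≤ 2 π
isometric≤2 p≤n π iso v w = mk⇔ (isometric≤2-forth p≤n π iso v w)
  (subst₂ (λ x y → numDiff (to v) (to w) ≤ 2 → numDiff x y ≤ 2)
    (strictlyInverseʳ v) (strictlyInverseʳ w)
    (isometric≤2-forth p≤n (↔-sym π) (isometric≤-sym {π = π} iso) (to v) (to w)))
  where open Inverse π

-- The coloured points

𝟎 : Vec Bool n
𝟎 {n} = replicate n false

weight : Vec Bool n → ℕ
weight v = numDiff v 𝟎

weight-𝟎 : ∀ n → weight {n} 𝟎 ≡ 0
weight-𝟎 n = numDiff-self {n} 𝟎

weight-flip : ∀ i (v : Vec Bool n) → lookup v i ≡ true → suc (weight (flip i v)) ≡ weight v
weight-flip {n} i v v[i] = begin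
  suc (numDiff (flip i v) 𝟎)  ≡⟨ cong suc (numDiff-sym (flip i v) 𝟎) ⟩
  suc (numDiff 𝟎 (flip i v))  ≡⟨ flip-differ i 𝟎 v
                                   (trans (lookup-replicate i false) (cong not (sym v[i]))) ⟩
  numDiff 𝟎 v                 ≡⟨ numDiff-sym 𝟎 v ⟩
  numDiff v 𝟎                 ∎
  where open ≡-Reasoning

support-element : ∀ (v : Vec Bool n) {d} → weight v ≡ suc d →
                  ∃[ i ] lookup v i ≡ true × weight (flip i v) ≡ d
support-element v eq =
  let i , differ = differing-coordinate v 𝟎 eq
      v[i] = trans differ (cong not (lookup-replicate i false))
  in i , v[i] , suc-injective (trans (weight-flip i v v[i]) eq)

-- Coordinate `i` stands for the element i + 1 of {0, ..., n}, where 0 is the parity bit. Thus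
-- `unit i` is the edge {0, i + 1} of the complete graph, and `pair i j` with `i ≢ j` is the edge {i
-- + 1, j + 1}.
unit : Fin n → Vec Bool n
unit i = flip i 𝟎

pair : Fin n → Fin n → Vec Bool n
pair i j = flip i (unit j)

unit-lookup-self : ∀ (i : Fin n) → lookup (unit i) i ≡ true
unit-lookup-self i = trans (lookup-flip i 𝟎) (cong not (lookup-replicate i false))

unit-lookup-≢ : ∀ {i j : Fin n} → i ≢ j → lookup (unit j) i ≡ false
unit-lookup-≢ {i = i} i≢j = trans (lookup-flip-≢ 𝟎 i≢j) (lookup-replicate i false)

pair-lookupˡ : ∀ {i j : Fin n} → i ≢ j → lookup (pair i j) i ≡ true
pair-lookupˡ {i = i} {j} i≢j = trans (lookup-flip i (unit j)) (cong not (unit-lookup-≢ i≢j))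

pair-lookupʳ : ∀ {i j : Fin n} → i ≢ j → lookup (pair i j) j ≡ true
pair-lookupʳ {i = i} {j} i≢j = trans (lookup-flip-≢ (unit j) (i≢j ∘ sym)) (unit-lookup-self j)

unit-lookup⇒≡ : ∀ {i l : Fin n} → lookup (unit i) l ≡ true → l ≡ i
unit-lookup⇒≡ {i = i} {l} eq with l Fin.≟ i
... | yes l≡i = l≡i
... | no  l≢i = contradiction (trans (sym eq) (unit-lookup-≢ l≢i)) λ ()

pair-lookup⇒≡ : ∀ {i j l : Fin n} → lookup (pair i j) l ≡ true → l ≡ i ⊎ l ≡ j
pair-lookup⇒≡ {i = i} {j} {l} eq with l Fin.≟ i
... | yes l≡i = inj₁ l≡i
... | no  l≢i = inj₂ (unit-lookup⇒≡ (trans (sym (lookup-flip-≢ (unit j) l≢i)) eq))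

-- Distances from a point to units and pairs

module _ (u : Vec Bool n) where

  unit-in : ∀ {i} → lookup u i ≡ true → suc (numDiff u (unit i)) ≡ weight u
  unit-in {i} u[i] =
    flip-differ i u 𝟎 (trans u[i] (cong not (sym (lookup-replicate i false))))

  unit-out : ∀ {i} → lookup u i ≡ false → numDiff u (unit i) ≡ suc (weight u)
  unit-out {i} u[i] = flip-agree i u 𝟎 (trans u[i] (sym (lookup-replicate i false)))

  module _ {i j : Fin n} (i≢j : i ≢ j) where

    pair-in : lookup u i ≡ true → suc (numDiff u (pair i j)) ≡ numDiff u (unit j)
    pair-in u[i] = flip-differ i u (unit j) (trans u[i] (cong not (sym (unit-lookup-≢ i≢j))))

    pair-out : lookup u i ≡ false → numDiff u (pair i j) ≡ suc (numDiff u (unit j))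
    pair-out u[i] = flip-agree i u (unit j) (trans u[i] (sym (unit-lookup-≢ i≢j)))

    pair-both : lookup u i ≡ true → lookup u j ≡ true → 2 + numDiff u (pair i j) ≡ weight u
    pair-both u[i] u[j] = trans (cong suc (pair-in u[i])) (unit-in u[j])

    pair-neither : lookup u i ≡ false → lookup u j ≡ false →
                   numDiff u (pair i j) ≡ 2 + weight u
    pair-neither u[i] u[j] = trans (pair-out u[i]) (cong suc (unit-out u[j]))

    pair-first : lookup u i ≡ true → lookup u j ≡ false → numDiff u (pair i j) ≡ weight u
    pair-first u[i] u[j] = suc-injective (trans (pair-in u[i]) (unit-out u[j]))

    pair-second : lookup u i ≡ false → lookup u j ≡ true → numDiff u (pair i j) ≡ weight u
    pair-second u[i] u[j] = trans (pair-out u[i]) (unit-in u[j])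

    pair-≤weight : lookup u i ≡ true ⊎ lookup u j ≡ true → numDiff u (pair i j) ≤ weight u
    pair-≤weight e with lookup u i in u[i] | lookup u j in u[j]
    ... | true  | true  = ≤-trans (m≤n+m _ 2) (≤-reflexive (pair-both u[i] u[j]))
    ... | true  | false = ≤-reflexive (pair-first u[i] u[j])
    ... | false | true  = ≤-reflexive (pair-second u[i] u[j])
    pair-≤weight (inj₁ ()) | false | false
    pair-≤weight (inj₂ ()) | false | false

    -- A pair disjoint from the support of `u` is at distance `2 + weight u`. With `pair-≤weight` as
    -- converse for weight at most 2, closeness to a pair detects whether `u` contains one of its
    -- two coordinates.
    pair-near⇒meets : 0 < weight u → numDiff u (pair i j) ≤ 2 →
                      lookup u i ≡ true ⊎ lookup u j ≡ true
    pair-near⇒meets pos near with lookup u i in u[i] | lookup u j in u[j]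
    ... | true  | _     = inj₁ refl
    ... | false | true  = inj₂ refl
    ... | false | false = contradiction
      (≤-trans (+-monoʳ-≤ 2 pos) (subst (_≤ 2) (pair-neither u[i] u[j]) near)) 1+n≰n

inject₁≢suc : ∀ (i : Fin n) → inject₁ i ≢ suc i
inject₁≢suc (suc i) eq = inject₁≢suc i (Fin.suc-injective eq)

-- The edges of the path 0 — 1 — ⋯ — n, as even subsets of {0, …, n} with the
-- element 0 (a parity bit) omitted.
path : Fin n → Vec Bool n
path zero    = unit zero
path (suc i) = pair (inject₁ i) (suc i)

path-lookup-self : ∀ (a : Fin n) → lookup (path a) a ≡ true
path-lookup-self {suc n} zero    = unit-lookup-self (zero {n})
path-lookup-self (suc i) = pair-lookupʳ (inject₁≢suc i)

path-lookup⇒ : ∀ (a l : Fin n) → lookup (path a) l ≡ true →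
               toℕ l ≡ toℕ a ⊎ suc (toℕ l) ≡ toℕ a
path-lookup⇒ zero    l eq = inj₁ (cong toℕ (unit-lookup⇒≡ eq))
path-lookup⇒ (suc i) l eq with pair-lookup⇒≡ {i = inject₁ i} {suc i} eq
... | inj₁ refl = inj₂ (cong suc (toℕ-inject₁ i))
... | inj₂ refl = inj₁ refl

-- Each path edge contains its own last coordinate. If the indices differed, each would have to be
-- the predecessor of the other.
path-injective : ∀ (a b : Fin n) → path a ≡ path b → a ≡ b
path-injective a b eq
  with path-lookup⇒ b a (trans (cong (λ v → lookup v a) (sym eq)) (path-lookup-self a))
     | path-lookup⇒ a b (trans (cong (λ v → lookup v b) eq) (path-lookup-self b))
... | inj₁ a≡b | _        = toℕ-injective a≡b
... | inj₂ _   | inj₁ b≡a = toℕ-injective (sym b≡a)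
... | inj₂ p   | inj₂ q   = contradiction (subst (λ t → suc t ≡ toℕ b) (sym q) p)
                                          (λ r → 1+n≰n (≤-trans (n≤1+n _) (≤-reflexive r)))

unit-weight : ∀ (i : Fin n) → weight (unit i) ≡ 1
unit-weight {n} i = trans (sym (weight-flip i (unit i) (unit-lookup-self i)))
  (cong suc (trans (cong weight (flip-involutive i 𝟎)) (weight-𝟎 n)))

pair-weight : ∀ {i j : Fin n} → i ≢ j → weight (pair i j) ≡ 2
pair-weight {i = i} {j} i≢j = trans (sym (weight-flip i (pair i j) (pair-lookupˡ i≢j)))
  (cong suc (trans (cong weight (flip-involutive i (unit j))) (unit-weight j)))

path-weight : ∀ (a : Fin n) → 0 < weight (path a) × weight (path a) ≤ 2
path-weight a@zero    rewrite unit-weight a = z<s , s≤s z≤n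
path-weight (suc i) rewrite pair-weight (inject₁≢suc i) = z<s , ≤-refl

path-near⇒ : ∀ (a b : Fin n) → numDiff (path a) (path b) ≤ 2 →
             toℕ a ≤ suc (toℕ b)
path-near⇒ zero zero _ = z≤n
-- Since `path zero` is a unit rather than a pair, the sides are exchanged before `pair-near⇒meets`
-- applies.
path-near⇒ {suc n} (suc i) zero near =
  case pair-near⇒meets (path (zero {n})) (inject₁≢suc i) (proj₁ (path-weight (zero {n})))
         (subst (_≤ 2) (numDiff-sym (path (suc i)) (path zero)) near) of λ where
    (inj₁ eq) → s≤s (≤-reflexive (trans (sym (toℕ-inject₁ i)) (cong toℕ (unit-lookup⇒≡ eq))))
    (inj₂ eq) → contradiction (unit-lookup⇒≡ {i = zero} {suc i} eq) λ ()
path-near⇒ a (suc i) near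
  with pair-near⇒meets (path a) (inject₁≢suc i) (proj₁ (path-weight a)) near
... | inj₁ eq with path-lookup⇒ a _ eq
...   | inj₁ e = ≤-trans (≤-reflexive (trans (sym e) (toℕ-inject₁ i))) (m≤n+m _ 2)
...   | inj₂ e = ≤-trans (≤-reflexive (trans (sym e) (cong suc (toℕ-inject₁ i)))) (n≤1+n _)
path-near⇒ a (suc i) near | inj₂ eq with path-lookup⇒ a _ eq
...   | inj₁ e = ≤-trans (≤-reflexive (sym e)) (n≤1+n _)
...   | inj₂ e = ≤-reflexive (sym e)

path-consecutive : ∀ (i : Fin n) → numDiff (path (inject₁ i)) (path (suc i)) ≤ 2
path-consecutive i = ≤-trans
  (pair-≤weight (path (inject₁ i)) (inject₁≢suc i) (inj₁ (path-lookup-self (inject₁ i))))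
  (proj₂ (path-weight (inject₁ i)))

-- The set {0, 1, 3, 5}, which contains just one edge of the path.
pendant : Vec Bool (5 + k)
pendant {k} = true ∷ false ∷ true ∷ false ∷ true ∷ 𝟎

pendant-weight : weight (pendant {k}) ≡ 3
pendant-weight {k} = cong (3 +_) (weight-𝟎 k)

pendant-gap : ∀ i → lookup (pendant {k}) (suc i) ≡ true →
              lookup (pendant {k}) (inject₁ i) ≡ true → ⊥
pendant-gap zero ()
pendant-gap (suc zero) _ ()
pendant-gap (suc (suc zero)) ()
pendant-gap (suc (suc (suc zero))) _ ()
pendant-gap (suc (suc (suc (suc i)))) eq _ =
  contradiction (trans (sym eq) (lookup-replicate i false)) λ ()

-- The support of `pendant` has three coordinates, no two of them consecutive. A later path edge
-- therefore meets it in one coordinate, leaving distance 3, or in none, leaving distance 5.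
pendant-near⇒ : ∀ (a : Fin (5 + k)) → numDiff (pendant {k}) (path a) ≤ 2 → a ≡ zero
pendant-near⇒ zero _ = refl
pendant-near⇒ {k} (suc i) near
  with lookup (pendant {k}) (inject₁ i) in eqˡ | lookup (pendant {k}) (suc i) in eqʳ
... | true  | true  = contradiction eqˡ (pendant-gap i eqʳ)
... | true  | false = contradiction (subst (_≤ 2)
  (trans (pair-first pendant (inject₁≢suc i) eqˡ eqʳ) (pendant-weight {k})) near) 1+n≰n
... | false | true  = contradiction (subst (_≤ 2)
  (trans (pair-second pendant (inject₁≢suc i) eqˡ eqʳ) (pendant-weight {k})) near) 1+n≰n
... | false | false = contradiction (≤-trans (m≤n+m 3 2) (subst (_≤ 2)
  (trans (pair-neither pendant (inject₁≢suc i) eqˡ eqʳ) (cong (2 +_) (pendant-weight {k})))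
  near)) 1+n≰n

pendant-near-path₀ : numDiff (pendant {k}) (path zero) ≤ 2
pendant-near-path₀ {k} = ≤-reflexive (suc-injective
  (trans (unit-in (pendant {k}) {zero} refl) (pendant-weight {k})))

data Marked {k} : Vec Bool (5 + k) → Set where
  origin : Marked 𝟎
  tip    : Marked pendant
  edge   : ∀ a → Marked (path a)

Vec-≟ : (v w : Vec Bool n) → Dec (v ≡ w)
Vec-≟ = ≡-dec _≟ᵇ_

marked? : ∀ (v : Vec Bool (5 + k)) → Dec (Marked v)
marked? {k} v with Vec-≟ v 𝟎 | Vec-≟ v (pendant {k}) | any? (λ a → Vec-≟ v (path a))
... | yes refl | _        | _              = yes origin
... | no  _    | yes refl | _              = yes tip
... | no  _    | no  _    | yes (a , refl) = yes (edge a)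
... | no  v≢𝟎  | no  v≢p  | no  v≢path     = no λ where
      origin   → v≢𝟎 refl
      tip      → v≢p refl
      (edge a) → v≢path (a , refl)

𝟎≢path : ∀ (a : Fin n) → 𝟎 ≢ path a
𝟎≢path {n} a eq = <⇒≢ (proj₁ (path-weight a)) (trans (sym (weight-𝟎 n)) (cong weight eq))

-- Rigidity of the marked points

module MarkedRigid {k} (π : Vec Bool (5 + k) ↔ Vec Bool (5 + k))
  (isometric : Isometric≤ 2 π)
  (preserves : ∀ v → Marked v ⇔ Marked (Inverse.to π v)) where

  open Inverse π renaming (to to f; from to g)

  V : Set
  V = Vec Bool (5 + k)

  infix 4 _∼_
  _∼_ : V → V → Set
  v ∼ w = numDiff v w ≤ 2

  ∼-sym : ∀ v w → v ∼ w → w ∼ v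
  ∼-sym v w = subst (_≤ 2) (numDiff-sym v w)

  path∼𝟎 : (a : Fin (5 + k)) → path a ∼ 𝟎
  path∼𝟎 a = proj₂ (path-weight a)

  f-∼ : ∀ {v w} → v ∼ w → f v ∼ f w
  f-∼ = Equivalence.to (isometric _ _)

  f-∼⁻ : ∀ {v w} → f v ∼ f w → v ∼ w
  f-∼⁻ = Equivalence.from (isometric _ _)

  f-injective : ∀ {v w} → f v ≡ f w → v ≡ w
  f-injective = Injection.injective (↔⇒↣ π)

  path≢ : (a b : Fin (5 + k)) → a ≢ b → path a ≢ path b
  path≢ a b a≢b = a≢b ∘ path-injective a b

  𝟎≢edge : (a : Fin (5 + k)) → 𝟎 ≢ path a
  𝟎≢edge = 𝟎≢path

  pendant≢path : (a : Fin (5 + k)) → pendant ≢ path a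
  pendant≢path a eq = 1+n≰n (≤-trans
    (≤-reflexive (trans (sym (pendant-weight {k})) (cong weight eq))) (proj₂ (path-weight a)))

  Fixed : V → Set
  Fixed v = f v ≡ v

  f-marked : ∀ {v} → Marked v → Marked (f v)
  f-marked = Equivalence.to (preserves _)

  g-marked : ∀ {v} → Marked v → Marked (g v)
  g-marked {v} mv = Equivalence.from (preserves (g v)) (subst Marked (sym (strictlyInverseˡ v)) mv)

  fixed-∼ : ∀ {v x} → Fixed x → v ∼ x → f v ∼ x
  fixed-∼ {v} fx v∼x = subst (f v ∼_) fx (f-∼ v∼x)

  fixed-∼⁻ : ∀ {v x} → Fixed x → f v ∼ x → v ∼ x
  fixed-∼⁻ {v} fx fv∼x = f-∼⁻ (subst (f v ∼_) (sym fx) fv∼x)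

  hits-fixed : ∀ {v x} → Fixed x → f v ≡ x → v ≡ x
  hits-fixed fx eq = f-injective (trans eq (sym fx))

  private
    pend : V
    pend = pendant {k}

  origin≁pendant : ¬ (𝟎 ∼ pend)
  origin≁pendant near = contradiction
    (subst (_≤ 2) (trans (numDiff-sym 𝟎 pend) (pendant-weight {k})) near) 1+n≰n

  pendant-neighbour : ∀ {x} → Marked x → x ≢ pend → x ∼ pend → x ≡ path zero
  pendant-neighbour origin   _   near = contradiction near origin≁pendant
  pendant-neighbour tip      x≢p _    = contradiction refl x≢p
  pendant-neighbour (edge a) _   near =
    cong path (pendant-near⇒ {k} a (∼-sym (path a) pend near))

  -- Pulling back along `g` turns a marked neighbour of `f pend` into one of `pend`, which has only
  -- one.
  pendant-preimage-neighbour : ∀ {x} → Marked x → x ≢ f pend → x ∼ f pend → g x ≡ path zero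
  pendant-preimage-neighbour {x} mx x≢fp near = pendant-neighbour (g-marked mx)
    (λ eq → x≢fp (trans (sym (strictlyInverseˡ x)) (cong f eq)))
    (f-∼⁻ (subst (_∼ f pend) (sym (strictlyInverseˡ x)) near))

  -- The pendant vertex is the only marked one with at most one marked neighbour.
  two-neighbours : ∀ {x x′} → Marked x → Marked x′ → x ≢ x′ →
                   x ≢ f pend → x′ ≢ f pend → x ∼ f pend → x′ ∼ f pend → ⊥
  two-neighbours {x} {x′} mx mx′ x≢x′ x≢ x′≢ near near′ = x≢x′ (begin
    x            ≡⟨ strictlyInverseˡ x ⟨
    f (g x)      ≡⟨ cong f (trans (pendant-preimage-neighbour mx x≢ near)
                                  (sym (pendant-preimage-neighbour mx′ x′≢ near′))) ⟩
    f (g x′)     ≡⟨ strictlyInverseˡ x′ ⟩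
    x′           ∎)
    where open ≡-Reasoning

  -- Every other marked point has two marked neighbours: the origin has the first two path edges,
  -- `path zero` has the origin and its successor, and a later path edge has the origin and its
  -- predecessor.
  fixed-pendant : Fixed pend
  fixed-pendant with f pend in eq | f-marked tip
  ... | _ | tip    = refl
  ... | _ | origin = ⊥-elim
    (two-neighbours (edge zero) (edge (suc zero)) (path≢ zero (suc zero) λ ())
      (λ e → 𝟎≢edge zero (sym (trans e eq))) (λ e → 𝟎≢edge (suc zero) (sym (trans e eq)))
      (subst (path zero ∼_) (sym eq) (path∼𝟎 zero))
      (subst (path (suc zero) ∼_) (sym eq) (path∼𝟎 (suc zero))))
  ... | _ | edge zero = ⊥-elim
    (two-neighbours origin (edge (suc zero)) (𝟎≢edge (suc zero))
      (λ e → 𝟎≢edge zero (trans e eq))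
      (λ e → path≢ (suc zero) zero (λ ()) (trans e eq))
      (subst (𝟎 ∼_) (sym eq) (∼-sym (path zero) 𝟎 (path∼𝟎 zero)))
      (subst (path (suc zero) ∼_) (sym eq)
        (∼-sym (path zero) (path (suc zero)) (path-consecutive {4 + k} zero))))
  ... | _ | edge (suc i) = ⊥-elim
    (two-neighbours origin (edge (inject₁ i)) (𝟎≢edge (inject₁ i))
      (λ e → 𝟎≢edge (suc i) (trans e eq))
      (λ e → path≢ (inject₁ i) (suc i) (inject₁≢suc i) (trans e eq))
      (subst (𝟎 ∼_) (sym eq) (∼-sym (path (suc i)) 𝟎 (path∼𝟎 (suc i))))
      (subst (path (inject₁ i) ∼_) (sym eq) (path-consecutive i)))

  fixed-path₀ : Fixed (path zero)
  fixed-path₀ = pendant-neighbour (f-marked (edge zero))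
    (λ eq → pendant≢path zero (sym (hits-fixed fixed-pendant eq)))
    (fixed-∼ {path zero} fixed-pendant (∼-sym pend (path zero) (pendant-near-path₀ {k})))

  -- Otherwise the origin moves to path 1, and the neighbours path 1, path 2, path 3
  -- of the origin have only 𝟎 and path 2 to go to.
  fixed-𝟎 : Fixed 𝟎
  fixed-𝟎 with f 𝟎 in eq | f-marked origin
  ... | _ | origin = refl
  ... | _ | tip    = contradiction (hits-fixed fixed-pendant eq) λ ()
  ... | _ | edge a = ⊥-elim
    (three (target zero) (target (suc zero)) (target (suc (suc zero))))
    where
    near-path₀ : path a ∼ path zero
    near-path₀ = subst (_∼ path zero) eq
      (fixed-∼ {𝟎} fixed-path₀ (∼-sym (path zero) 𝟎 (path∼𝟎 zero)))
    only-1 : ∀ b → f 𝟎 ≡ path b → toℕ b ≤ 1 → b ≡ suc zero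
    only-1 zero          e _ = contradiction (hits-fixed fixed-path₀ e) (𝟎≢edge zero)
    only-1 (suc zero)    _ _ = refl
    only-1 (suc (suc _)) _ (s≤s ())
    f𝟎≡path₁ : f 𝟎 ≡ path (suc zero)
    f𝟎≡path₁ = trans eq (cong path (only-1 a eq (path-near⇒ a zero near-path₀)))
    Target : Fin (4 + k) → Set
    Target b = f (path (suc b)) ≡ 𝟎 ⊎ f (path (suc b)) ≡ path (suc (suc zero))
    target : ∀ b → Target b
    target b with f (path (suc b)) in e | f-marked (edge (suc b))
                | subst (f (path (suc b)) ∼_) f𝟎≡path₁ (f-∼ (path∼𝟎 (suc b)))
    ... | _ | origin | _ = inj₁ refl
    ... | _ | tip    | _ = contradiction (sym (hits-fixed fixed-pendant e)) (pendant≢path (suc b))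
    ... | _ | edge c | near with c | path-near⇒ c (suc zero) near
    ...   | zero | _ = contradiction (hits-fixed fixed-path₀ e) (path≢ (suc b) zero λ ())
    ...   | suc zero | _ = contradiction (f-injective (trans f𝟎≡path₁ (sym e))) (𝟎≢edge (suc b))
    ...   | suc (suc zero) | _ = inj₂ refl
    ...   | suc (suc (suc _)) | s≤s (s≤s ())
    clash : ∀ b c {x} → b ≢ c → f (path b) ≡ x → f (path c) ≡ x → ⊥
    clash b c b≢c eb ec = b≢c (path-injective b c (f-injective (trans eb (sym ec))))
    p₁ p₂ p₃ : Fin (5 + k)
    p₁ = suc zero
    p₂ = suc (suc zero)
    p₃ = suc (suc (suc zero))
    -- Pigeonhole: three distinct points cannot be sent injectively to two values.
    three : Target zero → Target (suc zero) → Target (suc (suc zero)) → ⊥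
    three (inj₁ p) (inj₁ q) _        = clash p₁ p₂ (λ ()) p q
    three (inj₂ p) (inj₂ q) _        = clash p₁ p₂ (λ ()) p q
    three (inj₁ p) _        (inj₁ r) = clash p₁ p₃ (λ ()) p r
    three (inj₂ p) _        (inj₂ r) = clash p₁ p₃ (λ ()) p r
    three _        (inj₁ q) (inj₁ r) = clash p₂ p₃ (λ ()) q r
    three _        (inj₂ q) (inj₂ r) = clash p₂ p₃ (λ ()) q r

  -- The image of a path edge is marked and close to its fixed predecessor, so its index is at most
  -- one beyond that predecessor; smaller indices are already taken by fixed edges. The bound `j`
  -- makes the recursion structural.
  fixed-path≤ : ∀ j a → toℕ a ≤ j → Fixed (path a)
  fixed-path≤ _       zero    _        = fixed-path₀
  fixed-path≤ (suc j) (suc i) (s≤s i≤j)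
    with f (path (suc i)) in eq | f-marked (edge (suc i))
       | fixed-∼ {path (suc i)} previous
           (∼-sym (path (inject₁ i)) (path (suc i)) (path-consecutive i))
    where
    previous : Fixed (path (inject₁ i))
    previous = fixed-path≤ j (inject₁ i) (≤-trans (≤-reflexive (toℕ-inject₁ i)) i≤j)
  ... | _ | origin | _ = contradiction (sym (hits-fixed fixed-𝟎 eq)) (𝟎≢edge (suc i))
  ... | _ | tip    | _ = contradiction (sym (hits-fixed fixed-pendant eq)) (pendant≢path (suc i))
  ... | _ | edge c | near with toℕ c ≤? j
  ...   | yes c≤j = sym (hits-fixed (fixed-path≤ j c c≤j) eq)
  ...   | no  c≰j = cong path (toℕ-injective (≤-antisym
            (≤-trans (path-near⇒ c (inject₁ i) near) (s≤s (≤-reflexive (toℕ-inject₁ i))))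
            (≤-trans (s≤s i≤j) (≰⇒> c≰j))))

  fixed-path : ∀ a → Fixed (path a)
  fixed-path a = fixed-path≤ _ a ≤-refl

-- Fixing every point

module Rigid {k} (π : Vec Bool (5 + k) ↔ Vec Bool (5 + k))
  (isometric : Isometric≤ 2 π)
  (preserves : ∀ v → Marked v ⇔ Marked (Inverse.to π v)) where

  open Inverse π renaming (to to f; from to g)
  open MarkedRigid {k} π isometric preserves

  image-weight≤2 : ∀ {v} → weight v ≤ 2 → weight (f v) ≤ 2
  image-weight≤2 {v} = fixed-∼ {v} fixed-𝟎

  image-weight-pos : ∀ {v} → 0 < weight v → 0 < weight (f v)
  image-weight-pos {v} pos = n≢0⇒n>0 λ w≡0 → <⇒≢ pos (sym (begin
    weight v    ≡⟨ cong weight (hits-fixed fixed-𝟎 (numDiff≡0⇒≡ (f v) 𝟎 w≡0)) ⟩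
    weight {5 + k} 𝟎 ≡⟨ weight-𝟎 (5 + k) ⟩
    0           ∎))
    where open ≡-Reasoning

  unit∼unit : ∀ (i j : Fin (5 + k)) → unit i ∼ unit j
  unit∼unit i j = ≤-trans (numDiff-triangle (unit i) 𝟎 (unit j))
    (≤-reflexive (cong₂ _+_ (unit-weight i) (trans (numDiff-sym 𝟎 (unit j)) (unit-weight j))))

  -- The image stays within distance 2 of the fixed `unit i`. As it misses `i`, its weight is at
  -- most 1, and containing `j` makes it `unit j`.
  fixed-unit-step : ∀ {j} i → Fixed (unit i) →
    lookup (f (unit j)) i ≡ false → lookup (f (unit j)) j ≡ true → Fixed (unit j)
  fixed-unit-step {j} i fixed u[i] u[j] = numDiff≡0⇒≡ u (unit j)
    (n≤0⇒n≡0 (s≤s⁻¹ (subst (_≤ 1) (sym (unit-in u u[j])) weight≤1)))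
    where
    u : V
    u = f (unit j)
    weight≤1 : weight u ≤ 1
    weight≤1 = s≤s⁻¹ (subst (_≤ 2) (unit-out u u[i]) (fixed-∼ {unit j} fixed (unit∼unit j i)))

  -- Path edges are fixed and closeness to them detects incidence, so a point of weight 1 or 2 and
  -- its image meet the same path edges.
  image-meets : ∀ v i → 0 < weight v → weight v ≤ 2 →
    (lookup v (inject₁ i) ≡ true ⊎ lookup v (suc i) ≡ true) →
    (lookup (f v) (inject₁ i) ≡ true ⊎ lookup (f v) (suc i) ≡ true)
  image-meets v i pos ≤2 meets = pair-near⇒meets (f v) (inject₁≢suc i) (image-weight-pos {v} pos)
    (fixed-∼ {v} (fixed-path (suc i))
      (≤-trans (pair-≤weight v (inject₁≢suc i) meets) ≤2))

  image-meets⁻ : ∀ v i → 0 < weight v → weight v ≤ 2 →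
    (lookup (f v) (inject₁ i) ≡ true ⊎ lookup (f v) (suc i) ≡ true) →
    (lookup v (inject₁ i) ≡ true ⊎ lookup v (suc i) ≡ true)
  image-meets⁻ v i pos ≤2 meets = pair-near⇒meets v (inject₁≢suc i) pos
    (fixed-∼⁻ {v} (fixed-path (suc i))
      (≤-trans (pair-≤weight (f v) (inject₁≢suc i) meets) (image-weight≤2 {v} ≤2)))

  unit-pos : ∀ (j : Fin (5 + k)) → 0 < weight (unit j)
  unit-pos j = ≤-reflexive (sym (unit-weight j))

  unit-≤2 : ∀ (j : Fin (5 + k)) → weight (unit j) ≤ 2
  unit-≤2 j = ≤-trans (≤-reflexive (unit-weight j)) (n≤1+n 1)

  image-unit-meets : ∀ i → lookup (f (unit (suc i))) (inject₁ i) ≡ true ⊎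
                           lookup (f (unit (suc i))) (suc i) ≡ true
  image-unit-meets i = image-meets (unit (suc i)) i (unit-pos (suc i)) (unit-≤2 (suc i))
    (inj₂ (unit-lookup-self (suc i)))

  -- An image containing coordinates 0 and 1 would be the fixed `path (suc zero)`. An image missing
  -- 1 must meet the path edge on 1 and 2 in coordinate 2, hence also meets the edge on 2 and 3,
  -- which `unit (suc zero)` does not.
  fixed-unit₁ : Fixed (unit (suc zero))
  fixed-unit₁ with lookup (f (unit (suc zero))) zero in u₀
                 | lookup (f (unit (suc zero))) (suc zero) in u₁
  ... | false | true  = fixed-unit-step zero (fixed-path zero) u₀ u₁
  ... | true  | true  = contradiction path₁≡unit₁ λ ()
    where
    u : V
    u = f (unit (suc zero))
    path₁≡unit₁ : unit (suc zero) ≡ path (suc zero)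
    path₁≡unit₁ = hits-fixed (fixed-path (suc zero)) (numDiff≡0⇒≡ u (path (suc zero))
      (n≤0⇒n≡0 (+-cancelˡ-≤ 2 _ 0 (subst (_≤ 2) (sym (pair-both u {zero} {suc zero} (λ ()) u₀ u₁))
        (image-weight≤2 {unit (suc zero)} (unit-≤2 (suc zero)))))))
  ... | _     | false with image-meets (unit (suc zero)) (suc zero)
                        (unit-pos (suc zero)) (unit-≤2 (suc zero)) (inj₁ refl)
  ...   | inj₁ u₁′ = contradiction (trans (sym u₁) u₁′) λ ()
  ...   | inj₂ u₂ with image-meets⁻ (unit (suc zero)) (suc (suc zero))
                        (unit-pos (suc zero)) (unit-≤2 (suc zero)) (inj₁ u₂)
  ...     | inj₁ ()
  ...     | inj₂ ()

  -- The path edge ending in the coordinate forces the image to contain that coordinate or the one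
  -- before. Once the latter is excluded, `fixed-unit-step` applies from the preceding fixed unit.
  fixed-unit≤ : ∀ j i → toℕ i ≤ j → Fixed (unit i)
  fixed-unit≤ _ zero _ = fixed-path zero
  fixed-unit≤ _ (suc zero) _ = fixed-unit₁
  fixed-unit≤ (suc j) (suc (suc i)) (s≤s i<j) = fixed-unit-step before
    (fixed-unit≤ j before (≤-trans (≤-reflexive (cong suc (toℕ-inject₁ i))) i<j))
    u[before] ([ (λ e → contradiction (trans (sym u[before]) e) λ ()) , id ]′
                 (image-unit-meets (suc i)))
    where
    before : Fin (5 + k)
    before = suc (inject₁ i)
    e = unit (suc (suc i))
    -- e misses the last path edge before the one ending in it, hence so does f e.
    u[before] : lookup (f e) before ≡ false
    u[before] with lookup (f e) before in eq
    ... | false = refl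
    ... | true with image-meets⁻ e (inject₁ i)
                      (unit-pos (suc (suc i))) (unit-≤2 (suc (suc i))) (inj₂ eq)
    ...   | inj₂ r = contradiction (unit-lookup⇒≡ r) (inject₁≢suc (suc i))
    ...   | inj₁ r = contradiction
      (trans (sym (trans (toℕ-inject₁ (inject₁ i)) (toℕ-inject₁ i))) (cong toℕ (unit-lookup⇒≡ r)))
      (<⇒≢ (s≤s (n≤1+n _)))

  fixed-unit : ∀ i → Fixed (unit i)
  fixed-unit i = fixed-unit≤ _ i ≤-refl

  weight1⇒unit : ∀ {v : V} → weight v ≡ 1 → ∃[ i ] v ≡ unit i
  weight1⇒unit {v} eq =
    let i , v[i] , w≡0 = support-element v eq
    in i , trans (sym (flip-involutive i v)) (cong (flip i) (numDiff≡0⇒≡ (flip i v) 𝟎 w≡0))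

  fixed-weight1 : ∀ {v} → weight v ≡ 1 → Fixed v
  fixed-weight1 {v} eq with i , refl ← weight1⇒unit {v} eq = fixed-unit i

  weight2⇒pair : ∀ {v : V} → weight v ≡ 2 → ∃[ i ] ∃[ j ] i ≢ j × v ≡ pair i j
  weight2⇒pair {v} eq with support-element v eq
  ... | i , v[i] , w≡1 with weight1⇒unit {flip i v} w≡1
  ...   | j , flip≡ = i , j , i≢j , trans (sym (flip-involutive i v)) (cong (flip i) flip≡)
    where
    i≢j : i ≢ j
    i≢j refl = contradiction (begin
      true                 ≡⟨ unit-lookup-self i ⟨
      lookup (unit i) i    ≡⟨ cong (λ w → lookup w i) flip≡ ⟨
      lookup (flip i v) i  ≡⟨ lookup-flip i v ⟩
      not (lookup v i)     ≡⟨ cong not v[i] ⟩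
      false                ∎) λ ()
      where open ≡-Reasoning

  -- The image has weight exactly 2, because the origin and all points of weight 1 are fixed. It
  -- stays within distance 2 of `unit i` and `unit j`, whereas a point of weight 2 missing a
  -- coordinate is at distance 3 from that unit.
  fixed-weight2 : ∀ {v} → weight v ≡ 2 → Fixed v
  fixed-weight2 {v} eq with weight2⇒pair {v} eq
  ... | i , j , i≢j , refl = numDiff≡0⇒≡ u (pair i j) (+-cancelˡ-≡ 2 _ 0
        (trans (pair-both u i≢j (support i pair∼unitˡ) (support j pair∼unitʳ)) weight-u))
    where
    u : V
    u = f (pair i j)
    weight-u : weight u ≡ 2
    weight-u with weight u in w | image-weight-pos {v} (≤-trans (s≤s z≤n) (≤-reflexive (sym eq)))
                 | image-weight≤2 {v} (≤-reflexive eq)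
    ... | 1 | _ | _ = contradiction
      (trans (sym w) (trans (cong weight (f-injective (fixed-weight1 {u} w))) eq)) λ ()
    ... | 2 | _ | _ = refl
    ... | suc (suc (suc _)) | _ | s≤s (s≤s ())
    support : ∀ l → pair i j ∼ unit l → lookup u l ≡ true
    support l near with lookup u l in u[l]
    ... | true  = refl
    ... | false = contradiction (subst (_≤ 2)
      (trans (unit-out u u[l]) (cong suc weight-u)) (fixed-∼ {pair i j} (fixed-unit l) near)) 1+n≰n
    pair∼unitˡ : pair i j ∼ unit i
    pair∼unitˡ = ≤-trans (n≤1+n _) (≤-reflexive (trans (unit-in (pair i j) (pair-lookupˡ i≢j)) eq))
    pair∼unitʳ : pair i j ∼ unit j
    pair∼unitʳ = ≤-trans (n≤1+n _) (≤-reflexive (trans (unit-in (pair i j) (pair-lookupʳ i≢j)) eq))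

  -- The induction step for weight at least 3. Clearing support coordinates of `v` gives fixed
  -- points of lower weight, and `f v` must be as close to those near `v` as `v` is, up to distance
  -- 2. Comparing `f v` with `v` at three support coordinates then gives a contradiction.
  module Descent (v : V) (lower : ∀ x → weight x < weight v → Fixed x)
    (moved : f v ≢ v) where

    u : V
    u = f v

    private
      d : ℕ
      d = numDiff u v

    weight-flip< : ∀ i (x : V) → lookup x i ≡ true → weight (flip i x) < weight x
    weight-flip< i x x[i] = ≤-reflexive (weight-flip i x x[i])

    lookup-flip₁ : ∀ {i j} → i ≢ j → lookup v i ≡ true → lookup (flip j v) i ≡ true
    lookup-flip₁ i≢j v[i] = trans (lookup-flip-≢ v i≢j) v[i]

    near₁ : ∀ {i} → lookup v i ≡ true → u ∼ flip i v
    near₁ {i} v[i] = fixed-∼ {v} (lower _ (weight-flip< i v v[i]))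
      (≤-trans (≤-reflexive (numDiff-flip i v)) (n≤1+n 1))

    near₂ : ∀ {i j} → i ≢ j → lookup v i ≡ true → lookup v j ≡ true → u ∼ flip i (flip j v)
    near₂ {i} {j} i≢j v[i] v[j] = fixed-∼ {v}
      (lower _ (<-trans (weight-flip< i (flip j v) (lookup-flip₁ i≢j v[i])) (weight-flip< j v v[j])))
      (≤-reflexive (trans (flip-agree i v (flip j v) (sym (lookup-flip-≢ v i≢j)))
                          (cong suc (numDiff-flip j v))))

    -- Clearing two coordinates of agreement adds 2 to the distance from `u`, which `near₂` permits
    -- only if `u` equals `v`.
    agree-twice : ∀ {i j} → i ≢ j → lookup v i ≡ true → lookup v j ≡ true →
                  lookup u i ≡ lookup v i → lookup u j ≡ lookup v j → ⊥
    agree-twice {i} {j} i≢j v[i] v[j] aᵢ aⱼ = moved (numDiff≡0⇒≡ u v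
      (n≤0⇒n≡0 (+-cancelˡ-≤ 2 d 0 (subst (_≤ 2)
        (trans (flip-agree i u (flip j v) (trans aᵢ (sym (lookup-flip-≢ v i≢j))))
               (cong suc (flip-agree j u v aⱼ)))
        (near₂ i≢j v[i] v[j])))))

    differ-twice : ∀ {i j} → i ≢ j →
      lookup u i ≡ not (lookup v i) → lookup u j ≡ not (lookup v j) →
      2 + numDiff u (flip i (flip j v)) ≡ d
    differ-twice {i} {j} i≢j dᵢ dⱼ = trans
      (cong suc (flip-differ i u (flip j v) (trans dᵢ (cong not (sym (lookup-flip-≢ v i≢j))))))
      (flip-differ j u v dⱼ)

    -- Two differences give `d` at least 2, and clearing a coordinate of agreement raises the
    -- distance to at least 3, against `near₁`.
    differ-twice-agree-once : ∀ {i j l} → i ≢ j → lookup v l ≡ true →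
      lookup u i ≡ not (lookup v i) → lookup u j ≡ not (lookup v j) →
      lookup u l ≡ lookup v l → ⊥
    differ-twice-agree-once {i} {j} {l} i≢j v[l] dᵢ dⱼ aₗ = 1+n≰n (begin
      3                                         ≤⟨ m≤m+n 3 _ ⟩
      3 + numDiff u (flip i (flip j v))         ≡⟨ cong suc (differ-twice i≢j dᵢ dⱼ) ⟩
      suc d                                     ≡⟨ flip-agree l u v aₗ ⟨
      numDiff u (flip l v)                      ≤⟨ near₁ v[l] ⟩
      2                                         ∎)
      where open ≤-Reasoning

    -- Clearing `l` leaves `u` within distance 2, and clearing `i` and `j` as well lowers the
    -- distance by 2. So `u` is the point `x` of lower weight, which is fixed and cannot also be the
    -- image of `v`.
    differ-thrice : ∀ {i j l} → i ≢ j → i ≢ l → j ≢ l →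
      lookup v i ≡ true → lookup v j ≡ true → lookup v l ≡ true →
      lookup u i ≡ not (lookup v i) → lookup u j ≡ not (lookup v j) →
      lookup u l ≡ not (lookup v l) → ⊥
    differ-thrice {i} {j} {l} i≢j i≢l j≢l v[i] v[j] v[l] dᵢ dⱼ dₗ =
      <⇒≢ x<v (cong weight (sym (hits-fixed (lower x x<v)
        (numDiff≡0⇒≡ u x (n≤0⇒n≡0 (+-cancelˡ-≤ 2 _ 0 (begin
          2 + numDiff u x               ≡⟨ cong suc (flip-differ i u (flip j (flip l v)) dᵢ′) ⟩
          suc (numDiff u (flip j (flip l v))) ≡⟨ flip-differ j u (flip l v) dⱼ′ ⟩
          numDiff u (flip l v)          ≤⟨ near₁ v[l] ⟩
          2                             ∎)))))))
      where
      open ≤-Reasoning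
      x : V
      x = flip i (flip j (flip l v))
      lookup-i : lookup (flip j (flip l v)) i ≡ lookup v i
      lookup-i = trans (lookup-flip-≢ (flip l v) i≢j) (lookup-flip-≢ v i≢l)
      lookup-j : lookup (flip l v) j ≡ lookup v j
      lookup-j = lookup-flip-≢ v j≢l
      dᵢ′ = trans dᵢ (cong not (sym lookup-i))
      dⱼ′ = trans dⱼ (cong not (sym lookup-j))
      x<v : weight x < weight v
      x<v = <-trans (weight-flip< i (flip j (flip l v)) (trans lookup-i v[i]))
              (<-trans (weight-flip< j (flip l v) (trans lookup-j v[j])) (weight-flip< l v v[l]))

    impossible : ∀ {i j l} → i ≢ j → i ≢ l → j ≢ l →
      lookup v i ≡ true → lookup v j ≡ true → lookup v l ≡ true → ⊥
    impossible {i} {j} {l} i≢j i≢l j≢l v[i] v[j] v[l]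
      -- The eight patterns are at least two agreements, exactly one, or none.
      with lookup u i ≟ᵇ lookup v i | lookup u j ≟ᵇ lookup v j | lookup u l ≟ᵇ lookup v l
    ... | yes aᵢ | yes aⱼ | _      = agree-twice i≢j v[i] v[j] aᵢ aⱼ
    ... | yes aᵢ | no  _  | yes aₗ = agree-twice i≢l v[i] v[l] aᵢ aₗ
    ... | no  _  | yes aⱼ | yes aₗ = agree-twice j≢l v[j] v[l] aⱼ aₗ
    ... | yes aᵢ | no  dⱼ | no  dₗ = differ-twice-agree-once j≢l v[i] (¬-not dⱼ) (¬-not dₗ) aᵢ
    ... | no  dᵢ | yes aⱼ | no  dₗ = differ-twice-agree-once i≢l v[j] (¬-not dᵢ) (¬-not dₗ) aⱼ
    ... | no  dᵢ | no  dⱼ | yes aₗ = differ-twice-agree-once i≢j v[l] (¬-not dᵢ) (¬-not dⱼ) aₗ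
    ... | no  dᵢ | no  dⱼ | no  dₗ =
      differ-thrice i≢j i≢l j≢l v[i] v[j] v[l] (¬-not dᵢ) (¬-not dⱼ) (¬-not dₗ)

  three-support-elements : ∀ (v : V) {d} → weight v ≡ 3 + d →
    ∃[ i ] ∃[ j ] ∃[ l ] (i ≢ j × i ≢ l × j ≢ l) ×
      lookup v i ≡ true × lookup v j ≡ true × lookup v l ≡ true
  three-support-elements v eq
    with i , v[i] , eq₁ ← support-element v eq
    with j , x[j] , eq₂ ← support-element (flip i v) eq₁
    with l , y[l] , _   ← support-element (flip j (flip i v)) eq₂
    = i , j , l , (i≢j , i≢l , j≢l) , v[i] , v[j] , v[l]
    where
    flipped : ∀ {m} (x : V) → lookup x m ≡ true → lookup (flip m x) m ≡ false
    flipped {m} x x[m] = trans (lookup-flip m x) (cong not x[m])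
    i≢j : i ≢ j
    i≢j refl = contradiction (trans (sym x[j]) (flipped v v[i])) λ ()
    v[j] : lookup v j ≡ true
    v[j] = trans (sym (lookup-flip-≢ v (i≢j ∘ sym))) x[j]
    j≢l : j ≢ l
    j≢l refl = contradiction (trans (sym y[l]) (flipped (flip i v) x[j])) λ ()
    x[l] : lookup (flip i v) l ≡ true
    x[l] = trans (sym (lookup-flip-≢ (flip i v) (j≢l ∘ sym))) y[l]
    i≢l : i ≢ l
    i≢l refl = contradiction (trans (sym x[l]) (flipped v v[i])) λ ()
    v[l] : lookup v l ≡ true
    v[l] = trans (sym (lookup-flip-≢ v (i≢l ∘ sym))) x[l]

  fixed-by-weight : ∀ w v → weight v ≡ w → Fixed v
  fixed-by-weight = <-rec (λ w → ∀ v → weight v ≡ w → Fixed v) step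
    where
    step : ∀ w → (∀ {w′} → w′ < w → ∀ v → weight v ≡ w′ → Fixed v) →
           ∀ v → weight v ≡ w → Fixed v
    step 0 _ v eq with refl ← numDiff≡0⇒≡ v 𝟎 eq = fixed-𝟎
    step 1 _ v eq = fixed-weight1 {v} eq
    step 2 _ v eq = fixed-weight2 {v} eq
    step (suc (suc (suc d))) ih v eq with Vec-≟ (f v) v
    ... | yes fixed = fixed
    ... | no  moved =
      let i , j , l , (i≢j , i≢l , j≢l) , v[i] , v[j] , v[l] = three-support-elements v eq
      in ⊥-elim (Descent.impossible v (λ x x<v → ih (subst (weight x <_) eq x<v) x refl) moved
           i≢j i≢l j≢l v[i] v[j] v[l])

  fixed : ∀ v → Fixed v
  fixed v = fixed-by-weight (weight v) v refl

-- The distinguishing colouring and the lower bound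

marking : ∀ p → Coloring (Q (5 + k) ^ᵍ p) 2
marking p v with marked? v
... | yes _ = suc zero
... | no  _ = zero

marking≡⇒marked : ∀ p {v w : Vec Bool (5 + k)} → marking p v ≡ marking p w → Marked v → Marked w
marking≡⇒marked p {v} {w} eq mv with marked? v | marked? w
... | _      | yes mw = mw
... | no ¬mv | no  _  = contradiction mv ¬mv
marking≡⇒marked p () mv | yes _ | no _

-- Dimension `5 + k` is `3 + (2 + k)`, so `p ≤ 2 + k` is the bound that `isometric≤2` asks for.
marking-distinguishing : ∀ {k p} → p ≤ 2 + k →
  Distinguishing (Q (5 + k) ^ᵍ suc p) (marking (suc p))
marking-distinguishing {k} {p} p≤2+k π preserves = Rigid.fixed {k} permutation
  (isometric≤2 p≤2+k permutation (automorphism-isometric≤ π))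
  (λ v → mk⇔ (marking≡⇒marked (suc p) (sym (preserves v))) (marking≡⇒marked (suc p) (preserves v)))
  where open Automorphism π

flip-automorphism : ∀ p (i : Fin n) → Automorphism (Q n ^ᵍ p)
flip-automorphism p i = record
  { permutation = mk↔ₛ′ (flip i) (flip i) (flip-involutive i) (flip-involutive i)
  ; ~-iff = λ v w → let same = numDiff-flip-flip i v w in mk⇔
      (λ a → Equivalence.from power-adjacent⇔
        (subst (λ d → 0 < d × d ≤ p) (sym same) (Equivalence.to power-adjacent⇔ a)))
      (λ a → Equivalence.from power-adjacent⇔
        (subst (λ d → 0 < d × d ≤ p) same (Equivalence.to power-adjacent⇔ a)))
  }

-- The cube is inhabited, so zero colours admit no colouring; with one colour, flipping the first
-- coordinate preserves every colouring yet moves the origin.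
distinguishing⇒2≤ : ∀ {n p} r → Σ[ c ∈ Coloring (Q (suc n) ^ᵍ p) r ]
  Distinguishing (Q (suc n) ^ᵍ p) c → 2 ≤ r
distinguishing⇒2≤ 0 (c , _) with () ← c 𝟎
distinguishing⇒2≤ {p = p} 1 (c , distinguishing) = contradiction
  (distinguishing (flip-automorphism p zero) (λ v → Fin1-≡ (c (flip zero v)) (c v)) 𝟎) λ ()
  where
  Fin1-≡ : ∀ (i j : Fin 1) → i ≡ j
  Fin1-≡ zero zero = refl
distinguishing⇒2≤ (suc (suc r)) _ = s≤s (s≤s z≤n)

corollary2p2 : (n p : ℕ) → 2 < p → p < n ∸ 1 → IsDistinguishingNumber (Q n ^ᵍ p) 2
corollary2p2 zero    _ _                         ()
-- The two bounds make the radius `3 + p` and the dimension 5 + k with p at most k, which leaves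
-- room for the five leading coordinates of `pendant`.
corollary2p2 (suc _) _ (s≤s (s≤s (s≤s {n = p} _))) (s≤s (s≤s (s≤s (s≤s p≤k)))) =
  (marking (3 + p) , marking-distinguishing (s≤s (s≤s p≤k))) , distinguishing⇒2≤
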